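{- Let $A,B$ and $S$ be non-empty subsets of a finite Abelian group $G$. If $|A|+|B|=|G|+L_S$, then $|A\wedge^S B|\ge |G|-2|S|$.
   Context: Groups are written additively. For subsets $A,B,S$ of a finite Abelian group $G$, the restricted sumset of $A$ and $B$ with respect to $S$ is $A\wedge^S B=\{a+b:\ a\in A,\ b\in B,\ a-b\notin S\}$. For $z\in G$, $L_S(z)=|\{(x,y)\in G\times G:\ x+y=z \text{ and } x-y\in S\}|$, and $L_S=\max_{z\in G}L_S(z)$. -}

module Defs where

open import Algebra.Bundles using (AbelianGroup)
open import Data.Fin.Base using (Fin)
open import Data.Fin.Properties using (any?)
import Data.Fin.Properties as Fin
open import Data.List.Base using (List; cartesianProduct; filter; length; map; tabulate)
open import Data.List.Extrema.Nat using (max)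
open import Data.Nat.Base using (ℕ)
open import Data.Product.Base using (∃; ∃₂; _×_; _,_)
open import Function.Base using (_∘_)
open import Function.Bundles using (Inverse)
open import Function.Properties.Inverse using (Inverse⇒Injection)
open import Level using (Level; _⊔_; suc)
open import Relation.Binary.Definitions using (_Respects_) renaming (Decidable to Decidable₂)
import Relation.Binary.PropositionalEquality as ≡
open import Relation.Nullary.Decidable using (Dec; map′; via-injection; ¬?; _×-dec_)
open import Relation.Nullary.Negation.Core using (¬_)
open import Relation.Unary using (Pred; Decidable)

record FiniteAbelianGroup (c ℓ : Level) : Set (suc (c ⊔ ℓ)) where
  field
    abelianGroup : AbelianGroup c ℓ

  open AbelianGroup abelianGroup public
    using (Carrier; _≈_; setoid; refl; sym; trans)
    renaming (_∙_ to _+_; ε to 0#; _⁻¹ to -_; ∙-cong to +-cong; ⁻¹-cong to -‿cong)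

  infixl 6 _-_
  _-_ : Carrier → Carrier → Carrier
  x - y = x + (- y)

  field
    order       : ℕ
    enumeration : Inverse setoid (≡.setoid (Fin order))

  open Inverse enumeration public using (to; from; strictlyInverseʳ)

  -- Lists each ≈-class exactly once.
  elements : List Carrier
  elements = tabulate from

  infix 4 _≈?_
  _≈?_ : Decidable₂ _≈_
  _≈?_ = via-injection (Inverse⇒Injection enumeration) Fin._≟_

  -‿cong₂ : ∀ {x x′ y y′} → x ≈ x′ → y ≈ y′ → x - y ≈ x′ - y′
  -‿cong₂ x≈x′ y≈y′ = +-cong x≈x′ (-‿cong y≈y′)

  ∃? : ∀ {p} {P : Pred Carrier p} → P Respects _≈_ → Decidable P → Dec (∃ P)
  ∃? resp P? = map′ (λ (i , p) → from i , p)
                    (λ (x , p) → to x , resp (sym (strictlyInverseʳ x)) p)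
                    (any? (P? ∘ from))

module _ {c ℓ : Level} (G : FiniteAbelianGroup c ℓ) where
  open FiniteAbelianGroup G

  -- Cardinalities of subsets only make sense constructively when membership
  -- is decidable; classically every subset of G is of this form.
  record Subset (p : Level) : Set (c ⊔ ℓ ⊔ suc p) where
    field
      Member   : Pred Carrier p
      member?  : Decidable Member
      respects : Member Respects _≈_

module _ {c ℓ : Level} {G : FiniteAbelianGroup c ℓ} where
  open FiniteAbelianGroup G
  open Subset

  infix 4 _∈_ _∈?_
  _∈_ : ∀ {p} → Carrier → Subset G p → Set p
  x ∈ A = Member A x

  _∈?_ : ∀ {p} (x : Carrier) (A : Subset G p) → Dec (x ∈ A)
  x ∈? A = member? A x

  Nonempty : ∀ {p} → Subset G p → Set (c ⊔ p)
  Nonempty A = ∃ λ x → x ∈ A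

  ∣_∣ : ∀ {p} → Subset G p → ℕ
  ∣ A ∣ = length (filter (_∈? A) elements)

  infix 6 _∧[_]_
  _∧[_]_ : ∀ {a s b} → Subset G a → Subset G s → Subset G b → Subset G (c ⊔ ℓ ⊔ a ⊔ s ⊔ b)
  _∧[_]_ {a} {s} {b} A S B = record
    { Member   = λ z → ∃₂ (Represents z)
    ; member?  = λ z → ∃? (λ x≈x′ (y , r) → y , resp x≈x′ refl refl r)
                          (λ x → ∃? (λ y≈y′ → resp refl y≈y′ refl) (represents? z x))
    ; respects = λ z≈z′ (x , y , r) → x , y , resp refl refl z≈z′ r
    }
    where
    Represents : Carrier → Carrier → Carrier → Set (ℓ ⊔ a ⊔ s ⊔ b)
    Represents z x y = x ∈ A × y ∈ B × ¬ (x - y ∈ S) × z ≈ x + y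

    represents? : ∀ z x y → Dec (Represents z x y)
    represents? z x y = (x ∈? A) ×-dec (y ∈? B) ×-dec ¬? (x - y ∈? S) ×-dec (z ≈? x + y)

    resp : ∀ {x x′ y y′ z z′} → x ≈ x′ → y ≈ y′ → z ≈ z′ → Represents z x y → Represents z′ x′ y′
    resp x≈x′ y≈y′ z≈z′ (x∈A , y∈B , x-y∉S , z≈x+y) =
        respects A x≈x′ x∈A
      , respects B y≈y′ y∈B
      , (λ x′-y′∈S → x-y∉S (respects S (-‿cong₂ (sym x≈x′) (sym y≈y′)) x′-y′∈S))
      , trans (sym z≈z′) (trans z≈x+y (+-cong x≈x′ y≈y′))

  -- L S z and Lmax S are L_S(z) and L_S = max_z L_S(z). The default value 0
  -- passed to max is harmless, since every L S z is at least 0.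
  L : ∀ {s} → Subset G s → Carrier → ℕ
  L S z = length (filter (λ (x , y) → (x + y ≈? z) ×-dec (x - y ∈? S))
                         (cartesianProduct elements elements))

  Lmax : ∀ {s} → Subset G s → ℕ
  Lmax S = max 0 (map (L S) elements)

{-# OPTIONS --safe #-}

-- Let N be the complement of A ∧^S B. If z ∈ N, then every pair with sum z in
-- A × B has its difference in S, so there are at most L_S such pairs, while
-- inclusion–exclusion gives at least |A| + |B| − |G| = L_S of them. Hence, for
-- x + y = z, at least one of x ∈ A, y ∈ B holds, and both hold exactly when
-- x − y ∈ S. These two facts yield |N ∩ C| ≤ 2 |S ∩ C| for each coset C of 2G:
-- after fixing n ∈ N ∩ C, n = y + b with y ∈ A, b ∈ B, and k ∈ N ∩ C with
-- k − 2b ∉ S (if there is no such k, then k ↦ k − 2b maps N ∩ C into S ∩ C),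
-- every j ∈ N ∩ C satisfies j − 2b ∈ S or (k − b + y) − j ∈ S.
module Submission where

open import Defs
open import Algebra.Bundles using (AbelianGroup)
open import Data.Empty using (⊥-elim)
open import Data.Fin.Base using (zero; suc)
import Data.Fin.Properties as Fin
open import Data.List.Base using (List; []; _∷_; length; map; filter; lookup)
open import Data.List.Extrema.Nat using (xs≤max)
open import Data.List.Membership.Propositional.Properties using (∈-lookup)
import Data.List.Membership.Setoid as Membership
import Data.List.Membership.Setoid.Properties as Membershipₚ
open import Data.List.Properties using (length-map; length-tabulate; filter-some; filter-none)
open import Data.List.Relation.Unary.All as All using (All; []; _∷_)
import Data.List.Relation.Unary.All.Properties as Allₚ
open import Data.List.Relation.Unary.AllPairs using ([]; _∷_)
open import Data.List.Relation.Unary.Any as Any using (Any; here)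
open import Data.List.Relation.Unary.Unique.Setoid using (Unique)
import Data.List.Relation.Unary.Unique.Setoid.Properties as Uniqueₚ
open import Data.Nat.Base using (ℕ; zero; suc; _+_; _*_; _∸_; _≤_; _<_; _≥_; s≤s; z≤n)
open import Data.Nat.Induction using (<-wellFounded)
import Data.Nat.Properties as ℕ
open import Algebra.Properties.CommutativeSemigroup ℕ.+-commutativeSemigroup
  using () renaming (interchange to ℕ-interchange)
open import Data.Product.Base using (∃; _×_; _,_; proj₁; proj₂)
open import Data.Product.Relation.Binary.Pointwise.NonDependent using (_×ₛ_)
open import Data.Sum.Base as Sum using (_⊎_; inj₁; inj₂)
open import Function.Base using (_∘_)
open import Function.Bundles using (Inverse)
open import Induction.WellFounded using (Acc; acc)
open import Level using (Level; _⊔_)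
open import Relation.Binary.Bundles using (Setoid)
open import Relation.Binary.Core using (Rel)
open import Relation.Binary.Definitions using () renaming (Decidable to Decidable₂)
open import Relation.Binary.Structures using (IsEquivalence)
open import Relation.Binary.PropositionalEquality using (_≡_; cong)
import Relation.Binary.PropositionalEquality as ≡
open import Relation.Nullary.Decidable using (Dec; yes; no; ¬?; decidable-stable)
open import Relation.Nullary.Negation using (¬_; contradiction)
open import Relation.Unary using (Pred; Decidable)
open FiniteAbelianGroup using (order)

private
  variable
    c₁ c₂ p q r ℓ₁ ℓ₂ : Level
    X : Set c₁

-- Counting in lists: inclusion-exclusion and its case of equality.

indicator : {P : Set p} → Dec P → ℕ
indicator (yes _) = 1
indicator (no _)  = 0

module _ {P : Set p} {Q : Set q} {R : Set r} where

  indicator-≤ : (P? : Dec P) (Q? : Dec Q) (R? : Dec R) → (P → Q → R) →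
                indicator P? + indicator Q? ≤ 1 + indicator R?
  indicator-≤ (yes _) (yes _) (yes _) _ = ℕ.≤-refl
  indicator-≤ (yes p) (yes q) (no ¬r) f = contradiction (f p q) ¬r
  indicator-≤ (yes _) (no _)  R?      _ = ℕ.m≤m+n 1 (indicator R?)
  indicator-≤ (no _)  (yes _) R?      _ = ℕ.m≤m+n 1 (indicator R?)
  indicator-≤ (no _)  (no _)  R?      _ = z≤n

  -- The extremal case of `indicator-≤`, which stays sound without `P → Q → R` because the
  -- inequality itself rules out the remaining cases.
  indicator-≥⁻ : (P? : Dec P) (Q? : Dec Q) (R? : Dec R) →
                 1 + indicator R? ≤ indicator P? + indicator Q? →
                 (P ⊎ Q) × (R → P × Q)
  indicator-≥⁻ (yes p) (yes q) _       _       = inj₁ p , λ _ → p , q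
  indicator-≥⁻ (yes p) (no _)  (no ¬r) _       = inj₁ p , λ r → contradiction r ¬r
  indicator-≥⁻ (no _)  (yes q) (no ¬r) _       = inj₂ q , λ r → contradiction r ¬r
  indicator-≥⁻ (yes _) (no _)  (yes _) (s≤s ())
  indicator-≥⁻ (no _)  (yes _) (yes _) (s≤s ())

module _ {P : Pred X p} (P? : Decidable P) where

  length-filter-∷ : ∀ x xs → length (filter P? (x ∷ xs)) ≡ indicator (P? x) + length (filter P? xs)
  length-filter-∷ x xs with P? x
  ... | yes _ = ≡.refl
  ... | no  _ = ≡.refl

  length-filter-∁ : ∀ xs → length xs ≡ length (filter P? xs) + length (filter (¬? ∘ P?) xs)
  length-filter-∁ []       = ≡.refl
  length-filter-∁ (x ∷ xs) with P? x
  ... | yes _ = cong suc (length-filter-∁ xs)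
  ... | no  _ = ≡.trans (cong suc (length-filter-∁ xs)) (≡.sym (ℕ.+-suc _ _))

module _ {P : Pred X p} {Q : Pred X q} {R : Pred X r}
         (P? : Decidable P) (Q? : Decidable Q) (R? : Decidable R)
         (P∩Q⊆R : ∀ {x} → P x → Q x → R x) where

  private
    lhs rhs : List X → ℕ
    lhs xs = length (filter P? xs) + length (filter Q? xs)
    rhs xs = length xs + length (filter R? xs)

    lhs₀ rhs₀ : X → ℕ
    lhs₀ x = indicator (P? x) + indicator (Q? x)
    rhs₀ x = 1 + indicator (R? x)

    lhs-∷ : ∀ x xs → lhs (x ∷ xs) ≡ lhs₀ x + lhs xs
    lhs-∷ x xs = ≡.trans (≡.cong₂ _+_ (length-filter-∷ P? x xs) (length-filter-∷ Q? x xs))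
                         (ℕ-interchange (indicator (P? x)) _ _ _)

    rhs-∷ : ∀ x xs → rhs (x ∷ xs) ≡ rhs₀ x + rhs xs
    rhs-∷ x xs = ≡.trans (cong (suc (length xs) +_) (length-filter-∷ R? x xs))
                         (ℕ-interchange 1 (length xs) (indicator (R? x)) _)

    lhs₀≤rhs₀ : ∀ x → lhs₀ x ≤ rhs₀ x
    lhs₀≤rhs₀ x = indicator-≤ (P? x) (Q? x) (R? x) P∩Q⊆R

  inclusion-exclusion-≤ : ∀ xs → length (filter P? xs) + length (filter Q? xs) ≤
                                 length xs + length (filter R? xs)
  inclusion-exclusion-≤ []       = z≤n
  inclusion-exclusion-≤ (x ∷ xs) = ≡.subst₂ _≤_ (≡.sym (lhs-∷ x xs)) (≡.sym (rhs-∷ x xs))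
    (ℕ.+-mono-≤ (lhs₀≤rhs₀ x) (inclusion-exclusion-≤ xs))

  -- A sum of termwise inequalities that is attained in total is attained in every term. Bounding
  -- the tail by `inclusion-exclusion-≤` and cancelling makes the head tight; bounding the head by
  -- `lhs₀≤rhs₀` and cancelling makes the tail tight.
  inclusion-exclusion-≥⁻ : ∀ xs → length xs + length (filter R? xs) ≤
                                  length (filter P? xs) + length (filter Q? xs) →
                           All (λ x → (P x ⊎ Q x) × (R x → P x × Q x)) xs
  inclusion-exclusion-≥⁻ []       _ = []
  inclusion-exclusion-≥⁻ (x ∷ xs) h =
    indicator-≥⁻ (P? x) (Q? x) (R? x)
      (ℕ.+-cancelʳ-≤ (rhs xs) _ _ (ℕ.≤-trans h′ (ℕ.+-monoʳ-≤ (lhs₀ x) (inclusion-exclusion-≤ xs)))) ∷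
    inclusion-exclusion-≥⁻ xs
      (ℕ.+-cancelˡ-≤ (rhs₀ x) _ _ (ℕ.≤-trans h′ (ℕ.+-monoˡ-≤ (lhs xs) (lhs₀≤rhs₀ x))))
    where
    h′ : rhs₀ x + rhs xs ≤ lhs₀ x + lhs xs
    h′ = ≡.subst₂ _≤_ (rhs-∷ x xs) (lhs-∷ x xs) h

module _ {P : Pred X p} {Q : Pred X q} (P? : Decidable P) (Q? : Decidable Q) where

  length-filter-filter : ∀ xs → length (filter P? (filter Q? xs)) ≤ length (filter P? xs)
  length-filter-filter []       = z≤n
  length-filter-filter (x ∷ xs) with Q? x
  ... | yes _ with P? x
  ...   | yes _ = s≤s (length-filter-filter xs)
  ...   | no  _ = length-filter-filter xs
  length-filter-filter (x ∷ xs) | no _ with P? x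
  ...   | yes _ = ℕ.m≤n⇒m≤1+n (length-filter-filter xs)
  ...   | no  _ = length-filter-filter xs

  length-filter-filter-⊆ : (∀ {x} → P x → Q x) → ∀ xs →
                           length (filter P? xs) ≤ length (filter P? (filter Q? xs))
  length-filter-filter-⊆ P⊆Q []       = z≤n
  length-filter-filter-⊆ P⊆Q (x ∷ xs) with P? x | Q? x
  ... | yes px | no ¬qx = contradiction (P⊆Q px) ¬qx
  ... | no  _  | no  _  = length-filter-filter-⊆ P⊆Q xs
  ... | yes px | yes _  with P? x
  ...   | yes _  = s≤s (length-filter-filter-⊆ P⊆Q xs)
  ...   | no ¬px = contradiction px ¬px
  length-filter-filter-⊆ P⊆Q (x ∷ xs) | no ¬px | yes _ with P? x
  ...   | yes px = contradiction px ¬px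
  ...   | no _   = length-filter-filter-⊆ P⊆Q xs

-- Comparing lengths one equivalence class at a time.

module _ {_~_ : Rel X r} (isEquivalence : IsEquivalence _~_) (_~?_ : Decidable₂ _~_) (c : ℕ) where
  private module ~ = IsEquivalence isEquivalence

  -- Strip the class of the first entry of `xs` from both lists, charge it to the bound for that
  -- class, and recurse on the shorter remainder. Only classes that meet `xs` need a bound, so the
  -- global estimate follows from one at each entry of `xs`.
  length-≤-by-classes : ∀ xs ys →
    All (λ n → length (filter (_~? n) xs) ≤ c * length (filter (_~? n) ys)) xs →
    length xs ≤ c * length ys
  length-≤-by-classes xs ys = go xs ys (<-wellFounded (length xs))
    where
    open ℕ.≤-Reasoning

    go : ∀ xs ys → Acc _<_ (length xs) →
         All (λ n → length (filter (_~? n) xs) ≤ c * length (filter (_~? n) ys)) xs →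
         length xs ≤ c * length ys
    go []             ys _         _            = z≤n
    go xs@(n ∷ xs₀)   ys (acc rec) hs@(hn ∷ _) = begin
      length xs                                                             ≡⟨ length-filter-∁ (_~? n) xs ⟩
      length (filter (_~? n) xs) + length xs′                               ≤⟨ ℕ.+-mono-≤ hn (go xs′ ys′ (rec shorter) hs′) ⟩
      c * length (filter (_~? n) ys) + c * length ys′                       ≡⟨ ℕ.*-distribˡ-+ c _ _ ⟨
      c * (length (filter (_~? n) ys) + length ys′)                         ≡⟨ cong (c *_) (length-filter-∁ (_~? n) ys) ⟨
      c * length ys                                                         ∎
      where
      ≁n? : Decidable (λ x → ¬ (x ~ n))
      ≁n? = ¬? ∘ (_~? n)
      xs′ = filter ≁n? xs
      ys′ = filter ≁n? ys

      shorter : length xs′ < length xs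
      shorter = begin-strict
        length xs′                              <⟨ ℕ.m<n+m _ (filter-some (_~? n) {xs} (here ~.refl)) ⟩
        length (filter (_~? n) xs) + length xs′ ≡⟨ length-filter-∁ (_~? n) xs ⟨
        length xs                               ∎

      -- An entry outside the class of `n` has a class disjoint from it, so on the `ys` side nothing
      -- of the class of `m` is lost.
      restrict : ∀ {m} → ¬ (m ~ n) × length (filter (_~? m) xs) ≤ c * length (filter (_~? m) ys) →
                 length (filter (_~? m) xs′) ≤ c * length (filter (_~? m) ys′)
      restrict {m} (m≁n , h) = begin
        length (filter (_~? m) xs′)     ≤⟨ length-filter-filter (_~? m) ≁n? xs ⟩
        length (filter (_~? m) xs)      ≤⟨ h ⟩
        c * length (filter (_~? m) ys)  ≤⟨ ℕ.*-monoʳ-≤ c (length-filter-filter-⊆ (_~? m) ≁n?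
                                             (λ x~m x~n → m≁n (~.trans (~.sym x~m) x~n)) ys) ⟩
        c * length (filter (_~? m) ys′) ∎

      hs′ : All (λ m → length (filter (_~? m) xs′) ≤ c * length (filter (_~? m) ys′)) xs′
      hs′ = All.zipWith restrict (Allₚ.all-filter ≁n? xs , Allₚ.filter⁺ ≁n? hs)

-- Cardinalities compared through injections.

module _ (R : Setoid c₂ ℓ₂) where
  open Setoid R
  open Membership R using () renaming (_∈_ to _∈ₗ_)

  lookup-injective : ∀ {xs} → Unique R xs → ∀ {i j} → lookup xs i ≈ lookup xs j → i ≡ j
  lookup-injective (x∉xs ∷ xs!) {zero}  {zero}  _ = ≡.refl
  lookup-injective (x∉xs ∷ xs!) {zero}  {suc j} e = contradiction e (All.lookup x∉xs (∈-lookup j))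
  lookup-injective (x∉xs ∷ xs!) {suc i} {zero}  e = contradiction (sym e) (All.lookup x∉xs (∈-lookup i))
  lookup-injective (x∉xs ∷ xs!) {suc i} {suc j} e = cong suc (lookup-injective xs! e)

  -- Pigeonhole on positions: each index of `xs` goes to the index at which its entry occurs in
  -- `ys`. Equal targets mean equivalent entries, hence equal sources.
  Unique-⊆⇒length-≤ : ∀ {xs ys} → Unique R xs → All (_∈ₗ ys) xs → length xs ≤ length ys
  Unique-⊆⇒length-≤ {xs} {ys} xs! xs⊆ys =
    Fin.injective⇒≤ {f = λ i → Any.index (lookup∈ i)}
      (λ {i} {j} e → lookup-injective xs! (Membershipₚ.index-injective R (lookup∈ i) (lookup∈ j) e))
    where
    lookup∈ : ∀ i → lookup xs i ∈ₗ ys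
    lookup∈ i = All.lookup xs⊆ys (∈-lookup i)

module _ (S : Setoid c₁ ℓ₁) (R : Setoid c₂ ℓ₂) where
  open Setoid S using () renaming (_≈_ to _≈₁_)
  open Setoid R using () renaming (_≈_ to _≈₂_)
  open Membership R using () renaming (_∈_ to _∈ₗ_)

  injection⇒length-≤ : ∀ {f xs ys} → (∀ {x y} → f x ≈₂ f y → x ≈₁ y) → Unique S xs →
                       All (λ x → f x ∈ₗ ys) xs → length xs ≤ length ys
  injection⇒length-≤ {f} {xs} {ys} inj xs! f∈ =
    ≡.subst (_≤ length ys) (length-map f xs)
      (Unique-⊆⇒length-≤ R (Uniqueₚ.map⁺ S R inj xs!) (Allₚ.map⁺ f∈))

-- Identities in Abelian groups and congruence modulo 2G.

module AbelianGroupLemmas {c ℓ} (G : AbelianGroup c ℓ) where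
  open AbelianGroup G
    renaming (_∙_ to _+ᴳ_; ε to 0#; _⁻¹ to -_; ∙-cong to +-cong; ∙-congˡ to +-congˡ; ∙-congʳ to +-congʳ)
  open import Algebra.Properties.AbelianGroup G
  open import Algebra.Properties.CommutativeSemigroup commutativeSemigroup using (interchange)
  open import Relation.Binary.Reasoning.Setoid setoid

  x+[y-x]≈y : ∀ x y → x +ᴳ (y - x) ≈ y
  x+[y-x]≈y x y = trans (comm x (y - x)) (//-rightDividesˡ x y)

  x≈y+z⇒x-y≈z : ∀ {x y z} → x ≈ y +ᴳ z → x - y ≈ z
  x≈y+z⇒x-y≈z {x} {y} {z} e = trans (+-congʳ e) (xyx⁻¹≈y y z)

  shift-neg : ∀ x z t → (x +ᴳ t) +ᴳ (z - t) ≈ x +ᴳ z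
  shift-neg x z t = begin
    (x +ᴳ t) +ᴳ (z - t)   ≈⟨ interchange x t z (- t) ⟩
    (x +ᴳ z) +ᴳ (t - t)   ≈⟨ +-congˡ (inverseʳ t) ⟩
    (x +ᴳ z) +ᴳ 0#        ≈⟨ identityʳ _ ⟩
    x +ᴳ z                ∎

  neg-shift : ∀ x z t → (x - t) +ᴳ (z +ᴳ t) ≈ x +ᴳ z
  neg-shift x z t = begin
    (x - t) +ᴳ (z +ᴳ t)   ≈⟨ comm _ _ ⟩
    (z +ᴳ t) +ᴳ (x - t)   ≈⟨ shift-neg z x t ⟩
    z +ᴳ x                ≈⟨ comm z x ⟩
    x +ᴳ z                ∎

  [x+t]-[z+t]≈x-z : ∀ x z t → (x +ᴳ t) - (z +ᴳ t) ≈ x - z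
  [x+t]-[z+t]≈x-z x z t = trans (+-congˡ (sym (⁻¹-∙-comm z t))) (shift-neg x (- z) t)

  x+w≈y+z⇒x-z≈y-w : ∀ {x y z w} → x +ᴳ w ≈ y +ᴳ z → x - z ≈ y - w
  x+w≈y+z⇒x-z≈y-w {x} {y} {z} {w} e = begin
    x - z                   ≈⟨ [x+t]-[z+t]≈x-z x z w ⟨
    (x +ᴳ w) - (z +ᴳ w)     ≈⟨ +-cong e (⁻¹-cong (comm z w)) ⟩
    (y +ᴳ z) - (w +ᴳ z)     ≈⟨ [x+t]-[z+t]≈x-z y w z ⟩
    y - w                   ∎

  infix 4 _≡2_

  -- Congruence modulo the subgroup 2G: its classes are the cosets of 2G.
  _≡2_ : Rel Carrier (c ⊔ ℓ)
  x ≡2 y = ∃ λ t → x ≈ y +ᴳ (t +ᴳ t)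

  ≡2-isEquivalence : IsEquivalence _≡2_
  ≡2-isEquivalence = record
    { refl  = λ {x} → 0# , sym (trans (+-congˡ (identityʳ 0#)) (identityʳ x))
    ; sym   = λ {x} {y} (t , e) → - t , sym (begin
        x +ᴳ (- t +ᴳ - t)                 ≈⟨ +-cong e (⁻¹-∙-comm t t) ⟩
        (y +ᴳ (t +ᴳ t)) - (t +ᴳ t)        ≈⟨ //-rightDividesʳ (t +ᴳ t) y ⟩
        y                                 ∎)
    ; trans = λ {x} {y} {z} (t , e) (u , f) → u +ᴳ t , (begin
        x                                 ≈⟨ e ⟩
        y +ᴳ (t +ᴳ t)                     ≈⟨ +-congʳ f ⟩
        (z +ᴳ (u +ᴳ u)) +ᴳ (t +ᴳ t)       ≈⟨ assoc z _ _ ⟩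
        z +ᴳ ((u +ᴳ u) +ᴳ (t +ᴳ t))       ≈⟨ +-congˡ (interchange u u t t) ⟩
        z +ᴳ ((u +ᴳ t) +ᴳ (u +ᴳ t))       ∎)
    }

  x-y-y≡2x : ∀ x y → (x - y) - y ≡2 x
  x-y-y≡2x x y = - y , assoc x (- y) (- y)

  -- Reflection in `v` moves `x` by twice `v - x`, so it preserves every coset of 2G.
  v+v-x≡2x : ∀ v x → (v +ᴳ v) - x ≡2 x
  v+v-x≡2x v x = v - x , sym (begin
    x +ᴳ ((v - x) +ᴳ (v - x))   ≈⟨ assoc x _ _ ⟨
    (x +ᴳ (v - x)) +ᴳ (v - x)   ≈⟨ +-congʳ (x+[y-x]≈y x v) ⟩
    v +ᴳ (v - x)                ≈⟨ assoc v v (- x) ⟨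
    (v +ᴳ v) - x                ∎)

  -- The letters below are those of trichotomy: n ≈ y + b, k ≈ u + b, j ≈ n + 2t.

  split-double : ∀ {n j y b t} → n ≈ y +ᴳ b → j ≈ n +ᴳ (t +ᴳ t) → j ≈ (y +ᴳ t) +ᴳ (b +ᴳ t)
  split-double {n} {j} {y} {b} {t} e f = begin
    j                       ≈⟨ f ⟩
    n +ᴳ (t +ᴳ t)           ≈⟨ +-congʳ e ⟩
    (y +ᴳ b) +ᴳ (t +ᴳ t)    ≈⟨ interchange y b t t ⟩
    (y +ᴳ t) +ᴳ (b +ᴳ t)    ∎

  [y+t]-[b-t]≈j-b-b : ∀ {j y b t} → j ≈ (y +ᴳ t) +ᴳ (b +ᴳ t) → (y +ᴳ t) - (b - t) ≈ (j - b) - b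
  [y+t]-[b-t]≈j-b-b {j} {y} {b} {t} e = x+w≈y+z⇒x-z≈y-w (sym (begin
    (j - b) +ᴳ (b - t)                  ≈⟨ assoc (j - b) b (- t) ⟨
    ((j - b) +ᴳ b) - t                  ≈⟨ +-congʳ (//-rightDividesˡ b j) ⟩
    j - t                               ≈⟨ +-congʳ e ⟩
    ((y +ᴳ t) +ᴳ (b +ᴳ t)) - t          ≈⟨ assoc (y +ᴳ t) (b +ᴳ t) (- t) ⟩
    (y +ᴳ t) +ᴳ ((b +ᴳ t) - t)          ≈⟨ +-congˡ (//-rightDividesʳ t b) ⟩
    (y +ᴳ t) +ᴳ b                       ∎))

  [u-t]-[b+t]≈u+y-j : ∀ {j y b t} u → j ≈ (y +ᴳ t) +ᴳ (b +ᴳ t) → (u - t) - (b +ᴳ t) ≈ (u +ᴳ y) - j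
  [u-t]-[b+t]≈u+y-j {j} {y} {b} {t} u e = x+w≈y+z⇒x-z≈y-w (begin
    (u - t) +ᴳ j                              ≈⟨ +-congˡ e ⟩
    (u - t) +ᴳ ((y +ᴳ t) +ᴳ (b +ᴳ t))         ≈⟨ assoc (u - t) _ _ ⟨
    ((u - t) +ᴳ (y +ᴳ t)) +ᴳ (b +ᴳ t)         ≈⟨ +-congʳ (neg-shift u y t) ⟩
    (u +ᴳ y) +ᴳ (b +ᴳ t)                      ∎)

  -- With `k - b` as `u`, the map sending j to u + y - j is thereby a reflection in the point
  -- `y +ᴳ r`, and so keeps j in its coset of 2G.
  u+y≈v+v : ∀ {n k y b r} → n ≈ y +ᴳ b → k ≈ n +ᴳ (r +ᴳ r) → (k - b) +ᴳ y ≈ (y +ᴳ r) +ᴳ (y +ᴳ r)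
  u+y≈v+v {n} {k} {y} {b} {r} e f = begin
    (k - b) +ᴳ y              ≈⟨ +-congʳ (x≈y+z⇒x-y≈z (begin
      k                         ≈⟨ f ⟩
      n +ᴳ (r +ᴳ r)             ≈⟨ +-congʳ (trans e (comm y b)) ⟩
      (b +ᴳ y) +ᴳ (r +ᴳ r)      ≈⟨ assoc b y _ ⟩
      b +ᴳ (y +ᴳ (r +ᴳ r))      ∎)) ⟩
    (y +ᴳ (r +ᴳ r)) +ᴳ y      ≈⟨ comm _ y ⟩
    y +ᴳ (y +ᴳ (r +ᴳ r))      ≈⟨ assoc y y _ ⟨
    (y +ᴳ y) +ᴳ (r +ᴳ r)      ≈⟨ interchange y y r r ⟩
    (y +ᴳ r) +ᴳ (y +ᴳ r)      ∎

-- Cardinalities of subsets and bounds by L_S.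

module _ {c ℓ} {G : FiniteAbelianGroup c ℓ} where
  open FiniteAbelianGroup G using (abelianGroup; elements; enumeration; from; to; strictlyInverseʳ; _≈?_; ∃?; -‿cong₂)
  open AbelianGroup abelianGroup
    renaming (_∙_ to _+ᴳ_; _⁻¹ to -_; ∙-cong to +-cong; ∙-congˡ to +-congˡ)
  open import Algebra.Properties.AbelianGroup abelianGroup
  open AbelianGroupLemmas abelianGroup
  open Membership setoid using () renaming (_∈_ to _∈ₗ_)
  open Subset

  ∈-elements : ∀ x → x ∈ₗ elements
  ∈-elements x = Membershipₚ.∈-resp-≈ setoid (strictlyInverseʳ x) (Membershipₚ.∈-tabulate⁺ setoid (to x))

  elements-unique : Unique setoid elements
  elements-unique = Uniqueₚ.tabulate⁺ setoid λ {i} {j} e →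
    ≡.trans (≡.sym (strictlyInverseˡ i)) (≡.trans (to-cong e) (strictlyInverseˡ j))
    where open Inverse enumeration using (strictlyInverseˡ; to-cong)

  length-elements : length elements ≡ order G
  length-elements = length-tabulate from

  ∣∣-injection : (P : Subset G p) (Q : Subset G q) {f : Carrier → Carrier} →
                 (∀ {x y} → f x ≈ f y → x ≈ y) → (∀ {x} → x ∈ P → f x ∈ Q) → ∣ P ∣ ≤ ∣ Q ∣
  ∣∣-injection P Q inj P⇒Q = injection⇒length-≤ setoid setoid inj
    (Uniqueₚ.filter⁺ setoid (_∈? P) elements-unique)
    (All.map (λ {x} x∈P → Membershipₚ.∈-filter⁺ setoid (_∈? Q) (respects Q) (∈-elements _) (P⇒Q x∈P))
             (Allₚ.all-filter (_∈? P) elements))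

  -- The set z - B. Its intersection with A consists of the first summands of the representations of
  -- z as an element of A plus an element of B.
  reflect : Carrier → Subset G p → Subset G p
  reflect z B = record
    { Member   = λ x → z - x ∈ B
    ; member?  = λ x → z - x ∈? B
    ; respects = λ x≈y → respects B (-‿cong₂ refl x≈y)
    }

  -- The first coordinates of the pairs counted by L_S(z), whose second coordinate is forced to be z
  -- - x.
  halves : Carrier → Subset G p → Subset G p
  halves z S = record
    { Member   = λ x → x - (z - x) ∈ S
    ; member?  = λ x → x - (z - x) ∈? S
    ; respects = λ x≈y → respects S (-‿cong₂ x≈y (-‿cong₂ refl x≈y))
    }

  -‿injectiveʳ : ∀ z {x y} → z - x ≈ z - y → x ≈ y
  -‿injectiveʳ z e = ⁻¹-injective (∙-cancelˡ z _ _ e)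

  -‿injectiveˡ : ∀ z {x y} → x - z ≈ y - z → x ≈ y
  -‿injectiveˡ z = ∙-cancelʳ (- z) _ _

  z-[z-x]≈x : ∀ z x → z - (z - x) ≈ x
  z-[z-x]≈x z x = x≈y+z⇒x-y≈z (sym (//-rightDividesˡ x z))

  ∣B∣≤∣reflect∣ : ∀ z (B : Subset G p) → ∣ B ∣ ≤ ∣ reflect z B ∣
  ∣B∣≤∣reflect∣ z B = ∣∣-injection B (reflect z B) {λ x → z - x} (-‿injectiveʳ z)
    (respects B (sym (z-[z-x]≈x z _)))

  -- The map from x to (x, z - x) is injective and lands among the counted pairs. The target is
  -- phrased at `from i` because `Lmax` is a maximum over the listed representatives.
  ∣halves∣≤L : ∀ z i (S : Subset G p) → z ≈ from i → ∣ halves z S ∣ ≤ L S (from i)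
  ∣halves∣≤L z i S z≈ = injection⇒length-≤ setoid (setoid ×ₛ setoid) {λ x → x , z - x} proj₁
    (Uniqueₚ.filter⁺ setoid (_∈? halves z S) elements-unique)
    (All.map (λ {x} x∈ → Membershipₚ.∈-filter⁺ (setoid ×ₛ setoid) _
               (λ (x≈ , y≈) (e , s) → trans (sym (+-cong x≈ y≈)) e , respects S (-‿cong₂ x≈ y≈) s)
               (Membershipₚ.∈-cartesianProduct⁺ setoid setoid (∈-elements x) (∈-elements (z - x)))
               (trans (x+[y-x]≈y x z) z≈ , x∈))
             (Allₚ.all-filter (_∈? halves z S) elements))

  ∣halves∣≤Lmax : ∀ z (S : Subset G p) → ∣ halves z S ∣ ≤ Lmax S
  ∣halves∣≤Lmax z S = ℕ.≤-trans (∣halves∣≤L z (to z) S (sym (strictlyInverseʳ z)))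
    (Allₚ.tabulate⁻ (Allₚ.map⁻ (xs≤max 0 (map (L S) elements))) (to z))

  ∣∣-positive : (P : Subset G p) → Nonempty P → 0 < ∣ P ∣
  ∣∣-positive P (x , x∈P) = filter-some (_∈? P) (Any.map (λ x≈y → respects P x≈y x∈P) (∈-elements x))

  -- For s in S, the pair (s, 0) has sum s and difference s, so it contributes to L_S(s).
  Lmax-positive : (S : Subset G p) → Nonempty S → 0 < Lmax S
  Lmax-positive S (s , s∈S) = ℕ.≤-trans
    (∣∣-positive (halves s S) (s , respects S (sym (z-[z-x]≈x s s)) s∈S)) (∣halves∣≤Lmax s S)

  -- Structure of the complement of the restricted sumset.

  module _ (A : Subset G p) (B : Subset G q) (S : Subset G r) (S≢∅ : Nonempty S)
           (∣A∣+∣B∣≡ : ∣ A ∣ + ∣ B ∣ ≡ order G + Lmax S) where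

    Missing : Pred Carrier _
    Missing z = ¬ (z ∈ A ∧[ S ] B)

    module _ {z} (z∉ : Missing z) where

      missing-difference : ∀ {x y} → z ≈ x +ᴳ y → x ∈ A → y ∈ B → x - y ∈ S
      missing-difference {x} {y} e x∈A y∈B =
        decidable-stable (x - y ∈? S) λ ∉S → z∉ (x , y , x∈A , y∈B , ∉S , e)

      private
        A∩zB⊆halves : ∀ {x} → x ∈ A → x ∈ reflect z B → x ∈ halves z S
        A∩zB⊆halves {x} = missing-difference (sym (x+[y-x]≈y x z))

        order+Lmax≤ : length elements + Lmax S ≤ ∣ A ∣ + ∣ reflect z B ∣
        order+Lmax≤ = begin
          length elements + Lmax S ≡⟨ cong (_+ Lmax S) length-elements ⟩
          order G + Lmax S         ≡⟨ ∣A∣+∣B∣≡ ⟨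
          ∣ A ∣ + ∣ B ∣            ≤⟨ ℕ.+-monoʳ-≤ ∣ A ∣ (∣B∣≤∣reflect∣ z B) ⟩
          ∣ A ∣ + ∣ reflect z B ∣  ∎
          where open ℕ.≤-Reasoning

        Dichotomy : Pred Carrier _
        Dichotomy x = (x ∈ A ⊎ x ∈ reflect z B) × (x ∈ halves z S → x ∈ A × x ∈ reflect z B)

        -- Since A ∩ (z - B) lies in `halves z S`, inclusion-exclusion bounds |A| + |z - B| above by
        -- |G| + |`halves z S`|. The size hypothesis and `∣halves∣≤Lmax` give the reverse
        -- inequality, so equality holds at every x.
        dichotomy : ∀ x → Dichotomy x
        dichotomy x = All.lookupₛ setoid
          (λ x≈y (f , g) → Sum.map (respects A x≈y) (respects (reflect z B) x≈y) f ,
             λ y∈ → let x∈A , x∈B = g (respects (halves z S) (sym x≈y) y∈)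
                    in respects A x≈y x∈A , respects (reflect z B) x≈y x∈B)
          (inclusion-exclusion-≥⁻ (_∈? A) (_∈? reflect z B) (_∈? halves z S) A∩zB⊆halves elements
            (ℕ.≤-trans (ℕ.+-monoʳ-≤ _ (∣halves∣≤Lmax z S)) order+Lmax≤))
          (∈-elements x)

        y≈z-x : ∀ {x y} → z ≈ x +ᴳ y → z - x ≈ y
        y≈z-x = x≈y+z⇒x-y≈z

      missing-cover : ∀ {x y} → z ≈ x +ᴳ y → x ∈ A ⊎ y ∈ B
      missing-cover {x} e = Sum.map₂ (respects B (y≈z-x e)) (proj₁ (dichotomy x))

      missing-members : ∀ {x y} → z ≈ x +ᴳ y → x - y ∈ S → x ∈ A × y ∈ B
      missing-members {x} e s =
        let x∈A , z-x∈B = proj₂ (dichotomy x) (respects S (-‿cong₂ refl (sym (y≈z-x e))) s)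
        in x∈A , respects B (y≈z-x e) z-x∈B

      -- If `halves z S` were empty, A and z - B would be disjoint, yet their sizes add up to at
      -- least |G| + L_S, which exceeds |G|.
      missing-representation : ∃ λ x → x - (z - x) ∈ S
      missing-representation with ∃? (respects (halves z S)) (_∈? halves z S)
      ... | yes h = h
      ... | no ∄ = contradiction (begin-strict
          length elements                                     <⟨ ℕ.m<m+n _ (Lmax-positive S S≢∅) ⟩
          length elements + Lmax S                            ≤⟨ order+Lmax≤ ⟩
          ∣ A ∣ + ∣ reflect z B ∣                             ≤⟨ inclusion-exclusion-≤ (_∈? A) (_∈? reflect z B) (_∈? halves z S) A∩zB⊆halves elements ⟩
          length elements + ∣ halves z S ∣                    ≡⟨ cong ((length elements +_) ∘ length)
                                                                   (filter-none (_∈? halves z S) (All.universal (λ x x∈ → ∄ (x , x∈)) elements)) ⟩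
          length elements + 0                                 ≡⟨ ℕ.+-identityʳ _ ⟩
          length elements                                     ∎) (ℕ.<-irrefl ≡.refl)
        where open ℕ.≤-Reasoning

    -- Assume the last two alternatives fail. Perturbing the representations of n and k by t then
    -- decides membership of each perturbed summand in turn, until `k ≈ u +ᴳ b` is seen to have both
    -- summands in A and B, which forces the first alternative.
    trichotomy : ∀ {n k j y b} → Missing n → Missing k → Missing j →
                 n ≈ y +ᴳ b → y - b ∈ S → j ≡2 n →
                 (k - b) - b ∈ S ⊎ (j - b) - b ∈ S ⊎ ((k - b) +ᴳ y) - j ∈ S
    trichotomy {n} {k} {j} {y} {b} n∉ k∉ j∉ n≈y+b y-b∈S (t , j≈n+2t)
      with (j - b) - b ∈? S | ((k - b) +ᴳ y) - j ∈? S
    ... | yes j-b-b∈S | _           = inj₂ (inj₁ j-b-b∈S)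
    ... | no _        | yes u+y-j∈S = inj₂ (inj₂ u+y-j∈S)
    ... | no j-b-b∉S  | no u+y-j∉S  = inj₁ (missing-difference k∉ k≈u+b u∈A b∈B)
      where
      u w : Carrier
      u = k - b
      w = n - u

      k≈u+b : k ≈ u +ᴳ b
      k≈u+b = sym (//-rightDividesˡ b k)

      n≈u+w : n ≈ u +ᴳ w
      n≈u+w = sym (x+[y-x]≈y u n)

      j≈[y+t]+[b+t] : j ≈ (y +ᴳ t) +ᴳ (b +ᴳ t)
      j≈[y+t]+[b+t] = split-double n≈y+b j≈n+2t

      b∈B : b ∈ B
      b∈B = proj₂ (missing-members n∉ n≈y+b y-b∈S)

      -- Adding t to both summands turns a representation of n into one of j without changing the
      -- difference.
      y+t∈A×b+t∈B : y +ᴳ t ∈ A × b +ᴳ t ∈ B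
      y+t∈A×b+t∈B = missing-members j∉ j≈[y+t]+[b+t]
        (respects S (sym ([x+t]-[z+t]≈x-z y b t)) y-b∈S)

      -- Otherwise n, written as (y + t) + (b - t), would have its difference j - 2b in S.
      b-t∉B : ¬ (b - t ∈ B)
      b-t∉B b-t∈B = j-b-b∉S (respects S ([y+t]-[b-t]≈j-b-b j≈[y+t]+[b+t])
        (missing-difference n∉ (trans n≈y+b (sym (shift-neg y b t))) (proj₁ y+t∈A×b+t∈B) b-t∈B))

      u+t∈A : u +ᴳ t ∈ A
      u+t∈A = Sum.fromInj₁ (⊥-elim ∘ b-t∉B)
        (missing-cover k∉ (trans k≈u+b (sym (shift-neg u b t))))

      -- Otherwise k, written as (u - t) + (b + t), would have its difference u + y - j in S.
      u-t∉A : ¬ (u - t ∈ A)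
      u-t∉A u-t∈A = u+y-j∉S (respects S ([u-t]-[b+t]≈u+y-j u j≈[y+t]+[b+t])
        (missing-difference k∉ (trans k≈u+b (sym (neg-shift u b t))) u-t∈A (proj₂ y+t∈A×b+t∈B)))

      w+t∈B : w +ᴳ t ∈ B
      w+t∈B = Sum.fromInj₂ (⊥-elim ∘ u-t∉A)
        (missing-cover n∉ (trans n≈u+w (sym (neg-shift u w t))))

      -- Now j is (u + t) + (w + t) with summands in A and B, so u - w lies in S; n is u + w with
      -- that same difference, which puts u in A.
      u∈A : u ∈ A
      u∈A = proj₁ (missing-members n∉ n≈u+w (respects S ([x+t]-[z+t]≈x-z u w t)
        (missing-difference j∉ (split-double n≈u+w j≈n+2t) u+t∈A w+t∈B)))

    -- Bounding the complement on each coset of 2G.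

    private
      infix 4 _~_ _~?_

      _~_ : Rel Carrier _
      _~_ = _≡2_

      module ~ = IsEquivalence ≡2-isEquivalence

      _~?_ : Decidable₂ _~_
      x ~? y = ∃? (λ t≈u e → trans e (+-congˡ (+-cong t≈u t≈u))) (λ t → x ≈? y +ᴳ (t +ᴳ t))

      missing? : Decidable Missing
      missing? z = ¬? (z ∈? A ∧[ S ] B)

      missing S-elements : List Carrier
      missing    = filter missing? elements
      S-elements = filter (_∈? S) elements

      -- Because f preserves cosets of 2G, it sends these entries into the part of S within the
      -- coset of `n`, not merely into S.
      class-injection : ∀ n {xs} (f : Carrier → Carrier) → (∀ {x y} → f x ≈ f y → x ≈ y) → (∀ x → f x ~ x) →
                        Unique setoid xs → All (_~ n) xs → All (λ x → f x ∈ S) xs →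
                        length xs ≤ length (filter (_~? n) S-elements)
      class-injection n f f-inj f~ xs! xs~n fxs∈S = injection⇒length-≤ setoid setoid {f} f-inj xs!
        (All.zipWith (λ (x~n , fx∈S) →
          Membershipₚ.∈-filter⁺ setoid (_~? n) (λ x≈y (t , e) → t , trans (sym x≈y) e)
            (Membershipₚ.∈-filter⁺ setoid (_∈? S) (respects S) (∈-elements _) fx∈S)
            (~.trans (f~ _) x~n)) (xs~n , fxs∈S))

      -- The factor 2 counts two injections into the part of S in this coset: translation by -2b
      -- where its value lies in S, and a reflection on the remaining elements.
      class-bound : ∀ {n} → Missing n →
                    length (filter (_~? n) missing) ≤ 2 * length (filter (_~? n) S-elements)
      class-bound {n} n∉ with y , y-b∈S ← missing-representation n∉ = bound
        where
        open ℕ.≤-Reasoning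

        b : Carrier
        b = n - y

        n≈y+b : n ≈ y +ᴳ b
        n≈y+b = sym (x+[y-x]≈y y n)

        f : Carrier → Carrier
        f j = (j - b) - b

        xs : List Carrier
        xs = filter (_~? n) missing

        xs! : Unique setoid xs
        xs! = Uniqueₚ.filter⁺ setoid (_~? n) (Uniqueₚ.filter⁺ setoid missing? elements-unique)

        xs~n : All (_~ n) xs
        xs~n = Allₚ.all-filter (_~? n) missing

        xs∉ : All Missing xs
        xs∉ = Allₚ.filter⁺ (_~? n) (Allₚ.all-filter missing? elements)

        f∈S? : Decidable (λ j → f j ∈ S)
        f∈S? j = f j ∈? S

        m : ℕ
        m = length (filter (_~? n) S-elements)

        f-bound : ∀ {ys} → Unique setoid ys → All (_~ n) ys → All (λ j → f j ∈ S) ys → length ys ≤ m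
        f-bound = class-injection n f (λ e → -‿injectiveˡ b (-‿injectiveˡ b e)) (λ j → x-y-y≡2x j b)

        exceptional : ¬ All (λ j → f j ∈ S) xs → ∃ λ k → (k ~ n × Missing k) × ¬ (f k ∈ S)
        exceptional ¬fxs∈S = Any.lookup some , All.lookupAny (All.zip (xs~n , xs∉)) some
          where
          some : Any (λ k → ¬ (f k ∈ S)) xs
          some = Allₚ.¬All⇒Any¬ f∈S? xs ¬fxs∈S

        bound : length xs ≤ 2 * m
        bound with All.all? f∈S? xs
        ... | yes fxs∈S = ℕ.≤-trans (f-bound xs! xs~n fxs∈S) (ℕ.m≤m+n m _)
        ... | no ¬fxs∈S with k , ((r , k≈n+2r) , k∉) , fk∉S ← exceptional ¬fxs∈S = begin
          length xs                                                        ≡⟨ length-filter-∁ f∈S? xs ⟩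
          length (filter f∈S? xs) + length (filter (¬? ∘ f∈S?) xs)         ≤⟨ ℕ.+-mono-≤ bound₁ bound₂ ⟩
          m + m                                                            ≡⟨ cong (m +_) (ℕ.+-identityʳ m) ⟨
          2 * m                                                            ∎
          where
          v : Carrier
          v = y +ᴳ r

          u+y≈2v : (k - b) +ᴳ y ≈ v +ᴳ v
          u+y≈2v = u+y≈v+v n≈y+b k≈n+2r

          bound₁ : length (filter f∈S? xs) ≤ m
          bound₁ = f-bound (Uniqueₚ.filter⁺ setoid f∈S? xs!) (Allₚ.filter⁺ f∈S? xs~n) (Allₚ.all-filter f∈S? xs)

          bound₂ : length (filter (¬? ∘ f∈S?) xs) ≤ m
          bound₂ = class-injection n (λ j → (v +ᴳ v) - j) (-‿injectiveʳ (v +ᴳ v)) (v+v-x≡2x v)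
            (Uniqueₚ.filter⁺ setoid (¬? ∘ f∈S?) xs!) (Allₚ.filter⁺ (¬? ∘ f∈S?) xs~n)
            (All.zipWith (λ ((j~n , j∉) , fj∉S) →
                exclude fj∉S (trichotomy n∉ k∉ j∉ n≈y+b y-b∈S j~n))
              (Allₚ.filter⁺ (¬? ∘ f∈S?) (All.zip (xs~n , xs∉)) , Allₚ.all-filter (¬? ∘ f∈S?) xs))
            where
            -- The choice of k rules out the first alternative and the filter on j the second,
            -- leaving the reflected point in S.
            exclude : ∀ {j} → ¬ (f j ∈ S) → f k ∈ S ⊎ f j ∈ S ⊎ ((k - b) +ᴳ y) - j ∈ S → (v +ᴳ v) - j ∈ S
            exclude _    (inj₁ fk∈S)        = contradiction fk∈S fk∉S
            exclude fj∉S (inj₂ (inj₁ fj∈S)) = contradiction fj∈S fj∉S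
            exclude _    (inj₂ (inj₂ s))    = respects S (-‿cong₂ u+y≈2v refl) s

    length-missing : length missing ≤ 2 * ∣ S ∣
    length-missing = length-≤-by-classes ≡2-isEquivalence _~?_ 2 missing S-elements
      (All.map class-bound (Allₚ.all-filter missing? elements))

    order∸2∣S∣≤ : order G ∸ 2 * ∣ S ∣ ≤ ∣ A ∧[ S ] B ∣
    -- Truncated subtraction is avoided by bounding |G| itself: G splits into the restricted sumset
    -- and its complement.
    order∸2∣S∣≤ = ℕ.m≤n+o⇒m∸n≤o (order G) (2 * ∣ S ∣) (begin
      order G                              ≡⟨ length-elements ⟨
      length elements                      ≡⟨ length-filter-∁ (_∈? A ∧[ S ] B) elements ⟩
      ∣ A ∧[ S ] B ∣ + length missing      ≤⟨ ℕ.+-monoʳ-≤ _ length-missing ⟩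
      ∣ A ∧[ S ] B ∣ + 2 * ∣ S ∣           ≡⟨ ℕ.+-comm _ (2 * ∣ S ∣) ⟩
      2 * ∣ S ∣ + ∣ A ∧[ S ] B ∣           ∎)
      where open ℕ.≤-Reasoning

theorem12 : ∀ {c ℓ a b s} (G : FiniteAbelianGroup c ℓ)
    (A : Subset G a) (B : Subset G b) (S : Subset G s) →
    Nonempty A → Nonempty B → Nonempty S →
    ∣ A ∣ + ∣ B ∣ ≡ order G + Lmax S →
    ∣ A ∧[ S ] B ∣ ≥ order G ∸ 2 * ∣ S ∣
theorem12 G A B S _ _ S≢∅ ∣A∣+∣B∣≡ = order∸2∣S∣≤ A B S S≢∅ ∣A∣+∣B∣≡
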